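{- For all CES-terms $M,P$ and every variable $y$, $\Upsilon(\mathsf{LET}\,y:=M\,\mathsf{in}\,P)=[\Upsilon M\backslash y]\Upsilon P$.
   Context: Terms up to $\alpha$-equivalence; substitution capture-avoiding. CES: terms $M::=V\mid\mathsf{let}\,x:=VW\,\mathsf{in}\,M$ ($x$ bound in $M$); values $V,W::=x\mid\lambda x.M$. $\mathsf{LET}\,y:=V\,\mathsf{in}\,P=[V/y]P$; $\mathsf{LET}\,y:=(\mathsf{let}\,x:=VW\,\mathsf{in}\,M)\,\mathsf{in}\,P=\mathsf{let}\,x:=VW\,\mathsf{in}\,(\mathsf{LET}\,y:=M\,\mathsf{in}\,P)$. CNF: terms $M::=V\mid V(W,x.M)$ ($x$ bound in $M$); values $V,W::=x\mid\lambda x.M$. Left substitution: $[V\backslash x]P=[V/x]P$; $[V(W,y.N)\backslash x]P=V(W,y.[N\backslash x]P)$. Map $\Upsilon$ from CES to CNF: $\Upsilon(x)=x$; $\Upsilon(\lambda x.M)=\lambda x.\Upsilon M$; $\Upsilon(\mathsf{let}\,x:=VW\,\mathsf{in}\,M)=\Upsilon V(\Upsilon W,x.\Upsilon M)$. -}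

module Defs where

-- Well-scoped de Bruijn syntax: terms are taken up to alpha-equivalence
-- (syntactic equality of de Bruijn terms), and substitution is
-- capture-avoiding by construction.

open import Data.Nat using (ℕ; zero; suc)
open import Data.Fin using (Fin; zero; suc)

-- CES syntax
--   terms  M ::= V | let x := V W in M      (x bound in M)
--   values V,W ::= x | λx.M

mutual
  data Tm (n : ℕ) : Set where
    val  : Val n → Tm n
    let′ : Val n → Val n → Tm (suc n) → Tm n

  data Val (n : ℕ) : Set where
    var : Fin n → Val n
    lam : Tm (suc n) → Val n

-- CNF syntax
--   terms  M ::= V | V(W, x.M)               (x bound in M)
--   values V,W ::= x | λx.M

mutual
  data CTm (n : ℕ) : Set where
    cval : CVal n → CTm n
    capp : CVal n → CVal n → CTm (suc n) → CTm n

  data CVal (n : ℕ) : Set where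
    cvar : Fin n → CVal n
    clam : CTm (suc n) → CVal n

Ren : ℕ → ℕ → Set
Ren n m = Fin n → Fin m

ext : ∀ {n m} → Ren n m → Ren (suc n) (suc m)
ext ρ zero    = zero
ext ρ (suc i) = suc (ρ i)

mutual
  renT : ∀ {n m} → Ren n m → Tm n → Tm m
  renT ρ (val V)      = val (renV ρ V)
  renT ρ (let′ V W M) = let′ (renV ρ V) (renV ρ W) (renT (ext ρ) M)

  renV : ∀ {n m} → Ren n m → Val n → Val m
  renV ρ (var i) = var (ρ i)
  renV ρ (lam M) = lam (renT (ext ρ) M)

Sub : ℕ → ℕ → Set
Sub n m = Fin n → Val m

exts : ∀ {n m} → Sub n m → Sub (suc n) (suc m)
exts σ zero    = var zero
exts σ (suc i) = renV suc (σ i)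

mutual
  subT : ∀ {n m} → Sub n m → Tm n → Tm m
  subT σ (val V)      = val (subV σ V)
  subT σ (let′ V W M) = let′ (subV σ V) (subV σ W) (subT (exts σ) M)

  subV : ∀ {n m} → Sub n m → Val n → Val m
  subV σ (var i) = σ i
  subV σ (lam M) = lam (subT (exts σ) M)

single : ∀ {n} → Val n → Sub (suc n) n
single V zero    = V
single V (suc i) = var i

_[_/0] : ∀ {n} → Tm (suc n) → Val n → Tm n
P [ V /0] = subT (single V) P

-- weaken P (whose variable 0 is y) under a new binder x placed just
-- outside y: variable 0 stays y, every other variable is shifted.
weakUnder : ∀ {n} → Tm (suc n) → Tm (suc (suc n))
weakUnder = renT (ext suc)

-- LET y := M in P   (y is variable 0 of P)
LET : ∀ {n} → Tm n → Tm (suc n) → Tm n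
LET (val V)      P = P [ V /0]
LET (let′ V W M) P = let′ V W (LET M (weakUnder P))

mutual
  crenT : ∀ {n m} → Ren n m → CTm n → CTm m
  crenT ρ (cval V)     = cval (crenV ρ V)
  crenT ρ (capp V W M) = capp (crenV ρ V) (crenV ρ W) (crenT (ext ρ) M)

  crenV : ∀ {n m} → Ren n m → CVal n → CVal m
  crenV ρ (cvar i) = cvar (ρ i)
  crenV ρ (clam M) = clam (crenT (ext ρ) M)

CSub : ℕ → ℕ → Set
CSub n m = Fin n → CVal m

cexts : ∀ {n m} → CSub n m → CSub (suc n) (suc m)
cexts σ zero    = cvar zero
cexts σ (suc i) = crenV suc (σ i)

mutual
  csubT : ∀ {n m} → CSub n m → CTm n → CTm m
  csubT σ (cval V)     = cval (csubV σ V)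
  csubT σ (capp V W M) = capp (csubV σ V) (csubV σ W) (csubT (cexts σ) M)

  csubV : ∀ {n m} → CSub n m → CVal n → CVal m
  csubV σ (cvar i) = σ i
  csubV σ (clam M) = clam (csubT (cexts σ) M)

csingle : ∀ {n} → CVal n → CSub (suc n) n
csingle V zero    = V
csingle V (suc i) = cvar i

-- left substitution [N \ x]P, where x is variable 0 of P
--   [V \ x]P          = [V/x]P
--   [V(W,y.N) \ x]P   = V(W, y.[N \ x]P)
leftSub : ∀ {n} → CTm n → CTm (suc n) → CTm n
leftSub (cval V)     P = csubT (csingle V) P
leftSub (capp V W N) P = capp V W (leftSub N (crenT (ext suc) P))

mutual
  ΥT : ∀ {n} → Tm n → CTm n
  ΥT (val V)      = cval (ΥV V)
  ΥT (let′ V W M) = capp (ΥV V) (ΥV W) (ΥT M)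

  ΥV : ∀ {n} → Val n → CVal n
  ΥV (var i) = cvar i
  ΥV (lam M) = clam (ΥT M)

module Submission where

-- Υ is a homomorphism of the two syntaxes: it commutes with renaming and
-- with substitution. The theorem then follows by induction on M: in the
-- value case LET and left substitution are both ordinary substitution; in
-- the let case both push the substitution under the same binder after
-- weakening P, and Υ commutes with that weakening.

open import Defs
open import Data.Nat using (ℕ; suc)
open import Data.Fin using (zero; suc)
open import Relation.Binary.PropositionalEquality
  using (_≡_; refl; cong; trans; module ≡-Reasoning)

private
  cong₃ : ∀ {A B C D : Set} (f : A → B → C → D) {a a′ b b′ c c′} →
          a ≡ a′ → b ≡ b′ → c ≡ c′ → f a b c ≡ f a′ b′ c′
  cong₃ f refl refl refl = refl

mutual
  ΥT-renT : ∀ {n m} (ρ : Ren n m) (M : Tm n) →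
            ΥT (renT ρ M) ≡ crenT ρ (ΥT M)
  ΥT-renT ρ (val V)      = cong cval (ΥV-renV ρ V)
  ΥT-renT ρ (let′ V W M) =
    cong₃ capp (ΥV-renV ρ V) (ΥV-renV ρ W) (ΥT-renT (ext ρ) M)

  ΥV-renV : ∀ {n m} (ρ : Ren n m) (V : Val n) →
            ΥV (renV ρ V) ≡ crenV ρ (ΥV V)
  ΥV-renV ρ (var i) = refl
  ΥV-renV ρ (lam M) = cong clam (ΥT-renT (ext ρ) M)

-- Stating the substitution lemma for any τ related to σ, rather than for
-- i ↦ ΥV (σ i) itself, avoids an extensionality lemma for csubT under cexts.
_≗Υ_ : ∀ {n m} → Sub n m → CSub n m → Set
σ ≗Υ τ = ∀ i → ΥV (σ i) ≡ τ i

exts-≗Υ : ∀ {n m} {σ : Sub n m} {τ : CSub n m} →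
          σ ≗Υ τ → exts σ ≗Υ cexts τ
exts-≗Υ         σ≗τ zero    = refl
exts-≗Υ {σ = σ} σ≗τ (suc i) =
  trans (ΥV-renV suc (σ i)) (cong (crenV suc) (σ≗τ i))

single-≗Υ : ∀ {n} (V : Val n) → single V ≗Υ csingle (ΥV V)
single-≗Υ V zero    = refl
single-≗Υ V (suc i) = refl

mutual
  ΥT-subT : ∀ {n m} {σ : Sub n m} {τ : CSub n m} → σ ≗Υ τ → (M : Tm n) →
            ΥT (subT σ M) ≡ csubT τ (ΥT M)
  ΥT-subT σ≗τ (val V)      = cong cval (ΥV-subV σ≗τ V)
  ΥT-subT σ≗τ (let′ V W M) =
    cong₃ capp (ΥV-subV σ≗τ V) (ΥV-subV σ≗τ W) (ΥT-subT (exts-≗Υ σ≗τ) M)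

  ΥV-subV : ∀ {n m} {σ : Sub n m} {τ : CSub n m} → σ ≗Υ τ → (V : Val n) →
            ΥV (subV σ V) ≡ csubV τ (ΥV V)
  ΥV-subV σ≗τ (var i) = σ≗τ i
  ΥV-subV σ≗τ (lam M) = cong clam (ΥT-subT (exts-≗Υ σ≗τ) M)

lemma20 : ∀ {n : ℕ} (M : Tm n) (P : Tm (suc n)) →
    ΥT (LET M P) ≡ leftSub (ΥT M) (ΥT P)
lemma20 (val V)      P = ΥT-subT (single-≗Υ V) P
lemma20 (let′ V W M) P = cong (capp (ΥV V) (ΥV W)) (begin
  ΥT (LET M (weakUnder P))                   ≡⟨ lemma20 M (weakUnder P) ⟩
  leftSub (ΥT M) (ΥT (renT (ext suc) P))     ≡⟨ cong (leftSub (ΥT M)) (ΥT-renT (ext suc) P) ⟩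
  leftSub (ΥT M) (crenT (ext suc) (ΥT P))    ∎)
  where open ≡-Reasoning
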